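{- Let $p_1,\ldots,p_r$ be distinct primes (not necessarily in increasing order), and let $\alpha_1,\ldots,\alpha_r$ be positive integers. Suppose that $$\prod_{0<t<s}(\alpha_t+1)\geqslant p_s-[\![r\neq s]\!]\qquad\text{for all } s=1,\ldots,r.$$ Then $p_1^{\alpha_1}\cdots p_r^{\alpha_r}$ is a covering number.
   Context: For $a\in\mathbb{Z}$ and a positive integer $n$, $a(\mathrm{mod}\ n)=\{a+nx: x\in\mathbb{Z}\}$ is the residue class with modulus $n$. A finite system of residue classes $\{a_i(\mathrm{mod}\ n_i)\}_{i=1}^k$ is a cover of $\mathbb{Z}$ if every integer lies in at least one of the classes $a_i(\mathrm{mod}\ n_i)$. A positive integer $n$ is called a covering number if there is a cover of $\mathbb{Z}$ whose moduli are all distinct, greater than one, and divisors of $n$. For a predicate $P$, $[\![P]\!]$ is $1$ if $P$ holds and $0$ otherwise. In $\prod_{0<t<s}$ the index $t$ runs over integers with $0<t<s$; the empty product (case $s=1$) equals $1$. -}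

module Defs where

open import Data.Bool.Base using (if_then_else_)
open import Data.Fin.Base using (Fin)
open import Data.Integer.Base as ℤ using (ℤ; +_)
open import Data.Nat.Base using (ℕ; _*_; _<_; NonZero)
open import Data.Nat.Divisibility using (_∣_)
open import Data.Product.Base using (∃-syntax)
open import Data.Vec.Functional using (Vector; foldr)
open import Function.Definitions using (Injective)
open import Level using (Level; 0ℓ)
open import Relation.Binary.PropositionalEquality.Core using (_≡_)
open import Relation.Nullary.Decidable.Core using (Dec; does)
open import Relation.Unary using (Pred; _∈_)

private
  variable
    ℓ : Level

⟦_⟧ : {P : Set ℓ} → Dec P → ℕ
⟦ P? ⟧ = if does P? then 1 else 0

∏ : {n : ℕ} → Vector ℕ n → ℕ
∏ = foldr _*_ 1

record ResidueClass : Set where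
  constructor _mod_
  field
    residue          : ℤ
    modulus          : ℕ
    .{{modulus-pos}} : NonZero modulus

open ResidueClass public using (residue; modulus)

members : ResidueClass → Pred ℤ 0ℓ
members C z = ∃[ x ] z ≡ residue C ℤ.+ (+ modulus C) ℤ.* x

IsCover : {k : ℕ} → Vector ResidueClass k → Set
IsCover {k} C = (z : ℤ) → ∃[ i ] z ∈ members (C i)

record CoveringNumber (n : ℕ) : Set where
  field
    positive : 0 < n
    {size}   : ℕ
    system   : Vector ResidueClass size
    cover    : IsCover system
    distinct : Injective _≡_ _≡_ (λ i → modulus (system i))
    moduli>1 : (i : Fin size) → 1 < modulus (system i)
    moduli∣n : (i : Fin size) → modulus (system i) ∣ n

{-# OPTIONS --safe #-}
-- Adjoin the primes one at a time, with N the part of the product used so far.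
-- The invariant is a system with distinct moduli > 1 dividing M = N p^j that
-- covers everything except one class c (mod M).  That class is the union of the
-- p classes c + M t (mod M p), and the t-th of these is contained in the class
-- c + M t (mod d p^(j+1)) for every divisor d of N.  Since N has at least p − 1
-- divisors, all but one of them can be covered by new moduli d p^(j+1), none of
-- which divides M because p ∤ N.  At the last prime there are p divisors, so
-- nothing is left over.
module Submission where

open import Defs
open import Data.Empty using (⊥-elim)
open import Data.Fin.Base using (Fin; zero; suc; toℕ; Fin′; inject; fromℕ<; splitAt; _↑ˡ_; _↑ʳ_)
open import Data.Fin.Properties using (join-splitAt; toℕ-fromℕ<; suc-injective; 0≢1+n)
open import Data.Integer.Base as ℤ using (ℤ; +_)
open import Data.Integer.DivMod using (_%ℕ_; _/ℕ_; a≡a%ℕn+[a/ℕn]*n; n%ℕd<d)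
open import Data.Integer.Properties as ℤ using (pos-*)
open import Data.Integer.Tactic.RingSolver using (solve-∀)
open import Data.Nat.Base using (ℕ; zero; suc; _+_; _*_; _∸_; _^_; _≤_; _<_; _≥_; s≤s; z≤n; NonZero; >-nonZero⁻¹; ≢-nonZero; ≢-nonZero⁻¹)
open import Data.Nat.Divisibility
open import Data.Nat.Primality using (Prime; euclidsLemma; prime⇒nonZero; prime⇒irreducible; ¬prime[1])
open import Data.Nat.Properties hiding (suc-injective; 0≢1+n)
open import Data.Product.Base using (∃-syntax; _×_; _,_)
open import Data.Sum.Base using (_⊎_; inj₁; inj₂; [_,_]′)
open import Data.Vec.Functional using (Vector; _++_)
open import Data.Vec.Functional.Properties using (lookup-++ˡ; lookup-++ʳ)
open import Data.Vec.Functional.Relation.Unary.All.Properties using (++⁺)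
open import Function.Base using (_∘_)
open import Function.Definitions using (Injective)
open import Level using (0ℓ)
open import Relation.Binary.PropositionalEquality
open import Relation.Nullary.Decidable using (¬?)
open import Relation.Nullary.Decidable.Core using (yes; no)
open import Relation.Nullary.Negation.Core using (¬_)
open import Relation.Unary using (Pred; _∈_; _⊆_; ∅)

++-injective : {A : Set} (f : A → ℕ) {m n : ℕ} (xs : Vector A m) (ys : Vector A n) →
               Injective _≡_ _≡_ (f ∘ xs) → Injective _≡_ _≡_ (f ∘ ys) →
               (∀ i j → f (xs i) ≢ f (ys j)) →
               Injective _≡_ _≡_ (f ∘ (xs ++ ys))
++-injective f {m} {n} xs ys xs-inj ys-inj apart {i} {j} eq
  with splitAt m i | splitAt m j | join-splitAt m n i | join-splitAt m n j
-- Matching the `join-splitAt` equations turns `i` and `j` into images of `a` and `b`, so two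
-- indices in the same half reduce to injectivity of that half.
... | inj₁ a | inj₁ b | refl | refl = cong (_↑ˡ n) (xs-inj eq)
... | inj₁ a | inj₂ b | _    | _    = ⊥-elim (apart a b eq)
... | inj₂ a | inj₁ b | _    | _    = ⊥-elim (apart b a (sym eq))
... | inj₂ a | inj₂ b | refl | refl = cong (m ↑ʳ_) (ys-inj eq)

prime∣prime⇒≡ : ∀ {p q} → Prime p → Prime q → p ∣ q → p ≡ q
prime∣prime⇒≡ pp pq p∣q with prime⇒irreducible pq p∣q
... | inj₁ refl = ⊥-elim (¬prime[1] pp)
... | inj₂ p≡q  = p≡q

prime∣^⇒∣ : ∀ {p} m n → Prime p → p ∣ m ^ n → p ∣ m
prime∣^⇒∣ m zero    pp p∣1 with refl ← ∣1⇒≡1 p∣1 = ⊥-elim (¬prime[1] pp)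
prime∣^⇒∣ m (suc n) pp p∣m^1+n =
  [ (λ p∣m → p∣m) , prime∣^⇒∣ m n pp ]′ (euclidsLemma m (m ^ n) pp p∣m^1+n)

-- `U` bounds the uncovered integers from above; the system may meet it. The disjunction in `cover`
-- says which case applies to each `z`, so later steps can branch without deciding membership in
-- `U`.
record System (n : ℕ) (U : Pred ℤ 0ℓ) : Set where
  field
    {size}   : ℕ
    system   : Vector ResidueClass size
    cover    : (z : ℤ) → z ∈ U ⊎ ∃[ i ] z ∈ members (system i)
    distinct : Injective _≡_ _≡_ (λ i → modulus (system i))
    moduli>1 : (i : Fin size) → 1 < modulus (system i)
    moduli∣n : (i : Fin size) → modulus (system i) ∣ n

weaken : ∀ {m n U V} → m ∣ n → U ⊆ V → System m U → System n V
weaken m∣n U⊆V S = record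
  { system   = system
  ; cover    = λ z → [ inj₁ ∘ U⊆V , inj₂ ]′ (cover z)
  ; distinct = distinct
  ; moduli>1 = moduli>1
  ; moduli∣n = λ i → ∣-trans (moduli∣n i) m∣n
  } where open System S

coveringNumber : ∀ {n} → 0 < n → System n ∅ → CoveringNumber n
coveringNumber 0<n S = record
  { positive = 0<n
  ; system   = system
  ; cover    = λ z → [ (λ ()) , (λ c → c) ]′ (cover z)
  ; distinct = distinct
  ; moduli>1 = moduli>1
  ; moduli∣n = moduli∣n
  } where open System S

Progression : ℤ → ℕ → Pred ℤ 0ℓ
Progression c n z = ∃[ y ] z ≡ c ℤ.+ + n ℤ.* y

NearCover : ℕ → Set
NearCover n = ∃[ c ] System n (Progression c n)

-- What is left of the class `c` modulo `n` once its subclasses modulo `n * p` with index below `k`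
-- have been filled.
Unfilled : ℤ → ℕ → (p : ℕ) .{{_ : NonZero p}} → ℕ → Pred ℤ 0ℓ
Unfilled c n p k z = ∃[ y ] z ≡ c ℤ.+ + n ℤ.* y × k ≤ y %ℕ p

regroup : ∀ c m p t q → c ℤ.+ m ℤ.* (t ℤ.+ q ℤ.* p) ≡ (c ℤ.+ m ℤ.* t) ℤ.+ (m ℤ.* p) ℤ.* q
regroup = solve-∀

-- Divide `y` by `p`: the remainder selects the subclass and the quotient is the position inside it.
progression-split : ∀ c M p .{{_ : NonZero p}} y →
                    c ℤ.+ + M ℤ.* y ≡ (c ℤ.+ + M ℤ.* + (y %ℕ p)) ℤ.+ + (M * p) ℤ.* (y /ℕ p)
progression-split c M p y = begin
  c ℤ.+ + M ℤ.* y                                                   ≡⟨ cong (λ x → c ℤ.+ + M ℤ.* x) (a≡a%ℕn+[a/ℕn]*n y p) ⟩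
  c ℤ.+ + M ℤ.* (+ (y %ℕ p) ℤ.+ (y /ℕ p) ℤ.* + p)                   ≡⟨ regroup c (+ M) (+ p) (+ (y %ℕ p)) (y /ℕ p) ⟩
  (c ℤ.+ + M ℤ.* + (y %ℕ p)) ℤ.+ (+ M ℤ.* + p) ℤ.* (y /ℕ p)         ≡⟨ cong (λ x → (c ℤ.+ + M ℤ.* + (y %ℕ p)) ℤ.+ x ℤ.* (y /ℕ p)) (sym (pos-* M p)) ⟩
  (c ℤ.+ + M ℤ.* + (y %ℕ p)) ℤ.+ + (M * p) ℤ.* (y /ℕ p)             ∎
  where open ≡-Reasoning

progression-coarsen : ∀ {m n} → m ∣ n → ∀ c → Progression c n ⊆ Progression c m
progression-coarsen {m} (divides e refl) c (y , refl) =
  + e ℤ.* y , cong (λ x → c ℤ.+ x) (begin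
    + (e * m) ℤ.* y       ≡⟨ cong (λ x → + x ℤ.* y) (*-comm e m) ⟩
    + (m * e) ℤ.* y       ≡⟨ cong (λ x → x ℤ.* y) (pos-* m e) ⟩
    + m ℤ.* + e ℤ.* y     ≡⟨ ℤ.*-assoc (+ m) (+ e) y ⟩
    + m ℤ.* (+ e ℤ.* y)   ∎)
  where open ≡-Reasoning

nonZero∧∤⇒>1 : ∀ {m k} .{{_ : NonZero m}} → ¬ m ∣ k → 1 < m
nonZero∧∤⇒>1 {suc zero}    m∤k = ⊥-elim (m∤k (1∣ _))
nonZero∧∤⇒>1 {suc (suc m)} _   = s≤s (s≤s z≤n)

-- Non-divisibility of `M` does double duty: it separates the new moduli from the old ones, all of
-- which divide `M`, and it excludes the modulus 1.
extend : ∀ {M k} c p .{{_ : NonZero M}} .{{_ : NonZero p}} →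
         System M (Progression c M) → (m : Vector ℕ k) → Injective _≡_ _≡_ m →
         (∀ i → m i ∣ M * p) → (∀ i → ¬ m i ∣ M) →
         System (M * p) (Unfilled c M p k)
extend {M} {k} c p S m m-inj m∣Mp m∤M = record
  { system   = new ++ system
  ; cover    = cover′
  ; distinct = ++-injective modulus new system m-inj distinct
                 (λ i j eq → m∤M i (subst (_∣ M) (sym eq) (moduli∣n j)))
  ; moduli>1 = ++⁺ (λ C → 1 < modulus C) {xs = new}
                 (λ i → nonZero∧∤⇒>1 {{m≢0 i}} (m∤M i)) moduli>1
  ; moduli∣n = ++⁺ (λ C → modulus C ∣ M * p) {xs = new}
                 m∣Mp (λ i → ∣-trans (moduli∣n i) (m∣m*n p))
  }
  where
  open System S

  m≢0 : ∀ i → NonZero (m i)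
  m≢0 i = ≢-nonZero λ eq →
    ≢-nonZero⁻¹ (M * p) {{m*n≢0 M p}} (0∣⇒≡0 (subst (_∣ M * p) eq (m∣Mp i)))

  new : Vector ResidueClass k
  new i = _mod_ (c ℤ.+ + M ℤ.* + toℕ i) (m i) {{m≢0 i}}

  cover′ : ∀ z → z ∈ Unfilled c M p k ⊎ ∃[ i ] z ∈ members ((new ++ system) i)
  cover′ z with cover z
  ... | inj₂ (i , z∈Cᵢ) =
    inj₂ (k ↑ʳ i , subst (λ C → z ∈ members C) (sym (lookup-++ʳ new system i)) z∈Cᵢ)
  ... | inj₁ (y , refl) with k ≤? y %ℕ p
  ...   | yes k≤t = inj₁ (y , refl , k≤t)
  -- The remainder of `y` is itself the index of the new class. Membership holds modulo `M * p` and
  -- passes to the divisor `m i`.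
  ...   | no  k≰t = inj₂ (i ↑ˡ size , subst (λ C → z ∈ members C) (sym (lookup-++ˡ new system i))
                      (progression-coarsen (m∣Mp i) (c ℤ.+ + M ℤ.* + toℕ i) (y /ℕ p , z≡)))
    where
    i  = fromℕ< (≰⇒> k≰t)
    z≡ : z ≡ (c ℤ.+ + M ℤ.* + toℕ i) ℤ.+ + (M * p) ℤ.* (y /ℕ p)
    z≡ = trans (progression-split c M p y)
           (cong (λ t → (c ℤ.+ + M ℤ.* + t) ℤ.+ + (M * p) ℤ.* (y /ℕ p)) (sym (toℕ-fromℕ< (≰⇒> k≰t))))

unfilled-∅ : ∀ c M {k} p .{{_ : NonZero p}} → p ≤ k → Unfilled c M p k ⊆ ∅
unfilled-∅ c M p p≤k (y , _ , k≤t) = <⇒≱ (n%ℕd<d y p) (≤-trans p≤k k≤t)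

-- A remainder modulo `p` that is at least `p ∸ 1` equals `p ∸ 1`, so at most the last subclass
-- remains.
unfilled-last : ∀ c M {k} p .{{_ : NonZero p}} → p ∸ 1 ≤ k →
                Unfilled c M p k ⊆ Progression (c ℤ.+ + M ℤ.* + (p ∸ 1)) (M * p)
unfilled-last c M p@(suc p-1) p-1≤k (y , refl , k≤t) =
  y /ℕ p , subst (λ t → c ℤ.+ + M ℤ.* y ≡ (c ℤ.+ + M ℤ.* + t) ℤ.+ + (M * p) ℤ.* (y /ℕ p))
             (≤-antisym (≤-pred (n%ℕd<d y p)) (≤-trans p-1≤k k≤t))
             (progression-split c M p y)

-- Witnesses the lower bound `k` on the number of divisors of `n`.
record DivisorFamily (n k : ℕ) : Set where
  field
    divisor   : Vector ℕ k
    injective : Injective _≡_ _≡_ divisor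
    divisor∣n : ∀ i → divisor i ∣ n

module Adjoin {N p : ℕ} .{{N≢0 : NonZero N}} (p-prime : Prime p) (p∤N : ¬ p ∣ N)
              {k : ℕ} (F : DivisorFamily N k) where

  open DivisorFamily F

  private instance
    p≢0 : NonZero p
    p≢0 = prime⇒nonZero p-prime

  N*p^1+j : ∀ j → N * p ^ j * p ≡ N * p ^ suc j
  N*p^1+j j = trans (*-assoc N (p ^ j) p) (cong (N *_) (*-comm (p ^ j) p))

  fresh : ℕ → Vector ℕ k
  fresh j i = divisor i * p ^ suc j

  fresh-injective : ∀ j → Injective _≡_ _≡_ (fresh j)
  fresh-injective j eq = injective (*-cancelʳ-≡ _ _ (p ^ suc j) {{m^n≢0 p (suc j)}} eq)

  fresh-∣ : ∀ j i → fresh j i ∣ N * p ^ suc j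
  fresh-∣ j i = *-monoˡ-∣ (p ^ suc j) (divisor∣n i)

  -- Otherwise `p ^ suc j` would divide `N * p ^ j`, and cancelling `p ^ j` would give `p ∣ N`.
  fresh-∤ : ∀ j i → ¬ fresh j i ∣ N * p ^ j
  fresh-∤ j i fresh∣ =
    p∤N (*-cancelʳ-∣ (p ^ j) {{m^n≢0 p j}} (∣-trans (n∣m*n (divisor i)) fresh∣))

  -- By `fresh-∤` each further power of `p` contributes `k` divisors not seen before. The form
  -- `j + 1` matches the factors of the product in the hypothesis.
  divisors : ∀ j → DivisorFamily (N * p ^ j) (k * (j + 1))
  divisors zero    = subst₂ DivisorFamily (sym (*-identityʳ N)) (sym (*-identityʳ k)) F
  divisors (suc j) = subst (DivisorFamily _) (sym (*-suc k (j + 1))) (record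
    { divisor   = fresh j ++ G.divisor
    ; injective = ++-injective (λ d → d) (fresh j) G.divisor (fresh-injective j) G.injective
                    (λ a b eq → fresh-∤ j a (subst (_∣ N * p ^ j) (sym eq) (G.divisor∣n b)))
    ; divisor∣n = ++⁺ (_∣ N * p ^ suc j) {xs = fresh j} (fresh-∣ j)
                    (λ i → ∣-trans (G.divisor∣n i) (*-monoʳ-∣ N (n∣m*n p)))
    })
    where module G = DivisorFamily (divisors j)

  refine : ∀ j c → System (N * p ^ j) (Progression c (N * p ^ j)) →
           System (N * p ^ j * p) (Unfilled c (N * p ^ j) p k)
  refine j c S = extend c p {{m*n≢0 N (p ^ j) {{N≢0}} {{m^n≢0 p j}}}} S (fresh j) (fresh-injective j)
    (λ i → subst (fresh j i ∣_) (sym (N*p^1+j j)) (fresh-∣ j i)) (fresh-∤ j)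

  nearCover : p ∸ 1 ≤ k → NearCover N → ∀ j → NearCover (N * p ^ j)
  nearCover _     S zero    = subst NearCover (sym (*-identityʳ N)) S
  nearCover p-1≤k S (suc j) with nearCover p-1≤k S j
  ... | c , T = subst NearCover (N*p^1+j j)
                  (c ℤ.+ + (N * p ^ j) ℤ.* + (p ∸ 1) ,
                   weaken ∣-refl (unfilled-last c (N * p ^ j) p p-1≤k) (refine j c T))

  -- A single refinement at exponent 0 fills all `p` subclasses, so the last prime is needed only to
  -- the first power.
  fullCover : p ≤ k → NearCover N → System (N * p) ∅
  fullCover p≤k S with subst NearCover (sym (*-identityʳ N)) S
  ... | c , T = weaken (∣-reflexive (cong (_* p) (*-identityʳ N))) (unfilled-∅ c (N * p ^ 0) p p≤k) (refine 0 c T)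

-- Induction on the number of remaining primes. `N` collects the prime powers already adjoined, and
-- `k` stands for the matching part of the product in the bound.
adjoin-primes : ∀ r {N k} .{{_ : NonZero N}} → NearCover N → DivisorFamily N k →
  (p α : Fin (suc r) → ℕ) →
  (∀ i → Prime (p i)) →
  Injective _≡_ _≡_ p →
  (∀ i → 0 < α i) →
  (∀ i → ¬ p i ∣ N) →
  (∀ s → k * ∏ (λ (t : Fin′ s) → α (inject t) + 1) ≥ p s ∸ ⟦ ¬? (suc r ≟ suc (toℕ s)) ⟧) →
  CoveringNumber (N * ∏ (λ i → p i ^ α i))
adjoin-primes zero {N} {k} {{N≢0}} S F p α p-prime p-inj α>0 p∤N bound =
  coveringNumber (>-nonZero⁻¹ _ {{m*n≢0 N _ {{N≢0}} {{m*n≢0 (p zero ^ α zero) 1 {{m^n≢0 (p zero) (α zero) {{prime⇒nonZero (p-prime zero)}}}}}}}})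
    (weaken (*-monoʳ-∣ N (∣m⇒∣m*n 1 (m∣m^n (α>0 zero)))) (λ x → x)
      -- At the last prime the bracket evaluates to 0 and the product is empty, so the bound reads
      -- `p zero ≤ k * 1`.
      (fullCover (subst (p zero ≤_) (*-identityʳ k) (bound zero)) S))
  where
  open Adjoin (p-prime zero) (p∤N zero) F
  m∣m^n : ∀ {m n} → 0 < n → m ∣ m ^ n
  m∣m^n {m} {suc n} _ = m∣m*n (m ^ n)
adjoin-primes (suc r) {N} {k} {{N≢0}} S F p α p-prime p-inj α>0 p∤N bound =
  subst CoveringNumber (*-assoc N q _)
    (adjoin-primes r {{m*n≢0 N q {{N≢0}} {{m^n≢0 (p zero) (α zero) {{prime⇒nonZero (p-prime zero)}}}}}}
      -- More primes follow, so here the bracket evaluates to 1.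
      (nearCover (subst (p zero ∸ 1 ≤_) (*-identityʳ k) (bound zero)) S (α zero))
      (divisors (α zero))
      (p ∘ suc) (α ∘ suc) (p-prime ∘ suc) (suc-injective ∘ p-inj) (α>0 ∘ suc)
      p∤Nq
      -- The first factor `α zero + 1` of the product moves into `k`. The bracket keeps its value,
      -- since both numbers it compares drop by one.
      (λ s → ≤-trans (bound (suc s)) (≤-reflexive (sym (*-assoc k (α zero + 1) _)))))
  where
  open Adjoin (p-prime zero) (p∤N zero) F
  q = p zero ^ α zero
  p∤Nq : ∀ i → ¬ p (suc i) ∣ N * q
  p∤Nq i pᵢ∣Nq = [ p∤N (suc i) , pᵢ∤q ]′ (euclidsLemma N q (p-prime (suc i)) pᵢ∣Nq)
    where
    pᵢ∤q : ¬ p (suc i) ∣ q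
    pᵢ∤q pᵢ∣q = 0≢1+n (sym (p-inj (prime∣prime⇒≡ (p-prime (suc i)) (p-prime zero)
                  (prime∣^⇒∣ (p zero) (α zero) (p-prime (suc i)) pᵢ∣q))))

-- The empty system: the exceptional class 0 modulo 1 is all of ℤ.
nearCover-1 : NearCover 1
nearCover-1 = + 0 , record
  { size     = 0
  ; system   = λ ()
  ; cover    = λ z → inj₁ (z , sym (trans (ℤ.+-identityˡ _) (ℤ.*-identityˡ z)))
  ; distinct = λ { {()} }
  ; moduli>1 = λ ()
  ; moduli∣n = λ ()
  }

divisors-1 : DivisorFamily 1 1
divisors-1 = record
  { divisor   = λ _ → 1
  ; injective = λ { {zero} {zero} _ → refl }
  ; divisor∣n = λ _ → ∣-refl
  }

theorem1p1 : (r : ℕ) → r ≥ 1 →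
    (p α : Fin r → ℕ) →
    ((i : Fin r) → Prime (p i)) →
    Injective _≡_ _≡_ p →
    ((i : Fin r) → 0 < α i) →
    ((s : Fin r) → ∏ (λ (t : Fin′ s) → α (inject t) + 1) ≥ p s ∸ ⟦ ¬? (r ≟ suc (toℕ s)) ⟧) →
    CoveringNumber (∏ (λ i → p i ^ α i))
theorem1p1 (suc r) _ p α p-prime p-inj α>0 bound =
  subst CoveringNumber (*-identityˡ _)
    (adjoin-primes r nearCover-1 divisors-1 p α p-prime p-inj α>0
      (λ i pᵢ∣1 → ¬prime[1] (subst Prime (∣1⇒≡1 pᵢ∣1) (p-prime i)))
      (λ s → ≤-trans (bound s) (≤-reflexive (sym (*-identityˡ _)))))
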